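{- Any $G_{\delta\sigma}$ ideal $\mathcal J$ on $\omega$ is extendable to an $F_\sigma$ ideal, i.e. there is an $F_\sigma$ ideal $\mathcal J'$ on $\omega$ with $\mathcal J\subseteq\mathcal J'$.
   Context: An ideal on $\omega$ is a family of subsets of $\omega$ closed under finite unions and subsets, containing all finite sets and not containing $\omega$. $F_\sigma$ and $G_{\delta\sigma}$ (countable unions of $G_\delta$ sets) refer to subsets of $\mathcal P(\omega)$ with the Cantor space topology, identifying sets with characteristic functions in $\{0,1\}^\omega$. -}

module Defs where

open import Data.Bool.Base using (Bool; true; T; _∨_)
open import Data.List.Base using (List)
import Data.List.Membership.Propositional as List
open import Data.Nat.Base using (ℕ; _<_)
open import Data.Product.Base using (∃; _×_)
open import Level using (0ℓ)
open import Relation.Binary.PropositionalEquality.Core using (_≡_)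
open import Relation.Unary using (Pred; _∈_; _∉_; _⊆_; _≐_; ∁; ⋃; ⋂)

-- The Cantor space {0,1}^ω; a point is identified with the subset of ω of
-- which it is the characteristic function.
𝒫ω : Set
𝒫ω = ℕ → Bool

⟦_⟧ : 𝒫ω → Pred ℕ 0ℓ
⟦ A ⟧ n = T (A n)

ω : 𝒫ω
ω _ = true

_∪_ : 𝒫ω → 𝒫ω → 𝒫ω
(A ∪ B) n = A n ∨ B n

Finite : 𝒫ω → Set
Finite A = ∃ λ (ns : List ℕ) → ∀ {n} → n ∈ ⟦ A ⟧ → n List.∈ ns

Family : Set₁
Family = Pred 𝒫ω 0ℓ

-- The empty union needs no clause of its own: the empty set is finite.
-- Invariance under pointwise equality follows from ⊆-closed.
record IsIdeal (J : Family) : Set where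
  field
    ∪-closed : ∀ {A B} → A ∈ J → B ∈ J → (A ∪ B) ∈ J
    ⊆-closed : ∀ {A B} → ⟦ B ⟧ ⊆ ⟦ A ⟧ → A ∈ J → B ∈ J
    finite   : ∀ {A} → Finite A → A ∈ J
    proper   : ω ∉ J

-- The basic clopen set of all points that agree with x below n.
Cylinder : 𝒫ω → ℕ → Family
Cylinder x n y = ∀ {i} → i < n → y i ≡ x i

-- The product topology: the cylinders around x form a neighbourhood base.
IsOpen : Family → Set
IsOpen U = ∀ {x} → x ∈ U → ∃ λ n → Cylinder x n ⊆ U

IsClosed : Family → Set
IsClosed C = IsOpen (∁ C)

IsFσ : Family → Set₁
IsFσ A = ∃ λ (C : ℕ → Family) → (∀ n → IsClosed (C n)) × A ≐ ⋃ ℕ C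

IsGδ : Family → Set₁
IsGδ A = ∃ λ (U : ℕ → Family) → (∀ n → IsOpen (U n)) × A ≐ ⋂ ℕ U

IsGδσ : Family → Set₁
IsGδσ A = ∃ λ (G : ℕ → Family) → (∀ n → IsGδ (G n)) × A ≐ ⋃ ℕ G

{-# OPTIONS --safe #-}
module Submission where

-- Write J = ⋃ Gₙ with every Gₙ a Gδ family.  A family is M-coverable when
-- countably many closed subsets of the ideal M cover it.  It suffices to find a
-- proper ideal M ⊇ J such that every Gₙ is M-coverable: the closed sets
-- involved then generate an ideal between J and M, and this ideal is Fσ because
-- the Cantor space is compact (generated-Fσ-ideal).
--
-- M is chosen decisive: enlarge J in countably many steps so that each portion
-- of each Gₙ, i.e. its intersection with a basic clopen set, is M-coverable as
-- soon as some proper ideal N ⊇ M makes it N-coverable (decisive-extension).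
-- This is applied to the ideals N = M ↾ B = { A : A ∩ B ∈ M } for B ∉ M.
--
-- Suppose that G = Gₙ is not M-coverable.  The points of G with no M-coverable
-- neighbourhood in G form a nonempty kernel, and, M being decisive, for every
-- B ∉ M there is, arbitrarily close to any point of the kernel, a point q of
-- its closure with q ∩ B ∉ M (escape).  A fusion builds two sets A ⊆ x.  The set
-- x is a limit of such points q; at step n the current q is exchanged for a new
-- one, close to a point of G, so that x enters the n-th open set of G, and B is
-- replaced by q ∩ B.  Hence x ∈ G ⊆ J, and therefore A ∈ J.  New
-- elements of A are always taken from the current B, which keeps A inside x.
--
-- On the other hand A can be made to avoid every Gₙ.  Otherwise some Gₙ would be
-- dense in the compact set of all z with a given initial segment and with the
-- rest inside B, and by a Baire category argument two members of Gₙ ⊆ J would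
-- cover B up to a finite set, so that B ∈ J ⊆ M (dense⇒covering-pair,
-- avoiding-box).  So A lies in J but in no Gₙ, a contradiction.

open import Axiom.ExcludedMiddle using (ExcludedMiddle)
open import Data.Bool.Base using (Bool; true; false; T; _∧_; _∨_; not)
open import Data.Bool.Properties using (T?; T-∧; T-∨)
open import Data.Empty using (⊥; ⊥-elim)
open import Data.List.Base using (List; []; _∷_; length; replicate; upTo)
open import Data.List.Properties using (length-replicate)
open import Data.List.Membership.Propositional.Properties using (∈-upTo⁺)
open import Data.Nat.Base using (ℕ; zero; suc; _≤_; _<_; _⊔_; z≤n; s≤s; s<s; s<s⁻¹; _≤′_; ≤′-refl; ≤′-step)
open import Data.Nat.Binary.Base using (ℕᵇ; 2[1+_]; 1+[2_]; toℕ; fromℕ)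
open import Data.Nat.Binary.Properties using (fromℕ-toℕ)
open import Data.Nat.Properties
  using (_<?_; ≤-refl; ≤-trans; <⇒≤; <-≤-trans; ≤-<-trans; n<1+n; ≤⇒≤′; ≮⇒≥; <⇒≱;
         m≤m⊔n; m≤n⊔m; m<1+n⇒m<n∨m≡n; <-≤-connex)
open import Data.Product.Base using (∃; _×_; _,_; proj₁; proj₂)
open import Data.Sum.Base as Sum using (_⊎_; inj₁; inj₂; [_,_]′)
open import Function.Base using (id; _∘_; const)
open import Function.Bundles using (Equivalence; _↠_; mk↠ₛ; module Surjection)
open import Function.Construct.Composition using (_↠-∘_)
open import Level using (0ℓ)
open import Relation.Binary.PropositionalEquality using (_≡_; refl; sym; trans; cong; subst)
open import Relation.Nullary using (¬_; yes; no)
open import Relation.Nullary.Decidable using (isYes; toWitness; fromWitness; decidable-stable)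
open import Relation.Unary using (_∈_; _∉_; _⊆_; _≐_; ⋃)
open import Defs

open Equivalence using (to; from)

-- Subsets of ω

infix 4 _⊑_ _≈[_]_
infixl 7 _∩_ _∖_

_⊑_ : 𝒫ω → 𝒫ω → Set
A ⊑ B = ∀ i → T (A i) → T (B i)

∅ : 𝒫ω
∅ _ = false

_∩_ : 𝒫ω → 𝒫ω → 𝒫ω
(A ∩ B) i = A i ∧ B i

_∖_ : 𝒫ω → 𝒫ω → 𝒫ω
(A ∖ B) i = A i ∧ not (B i)

∖-intro : ∀ {x y : Bool} → T x → ¬ T y → T (x ∧ not y)
∖-intro {true} {false} _ _  = _
∖-intro {true} {true}  _ ¬y = ¬y _

∖-elim : ∀ {x y : Bool} → T (x ∧ not y) → T x × ¬ T y
∖-elim {true} {false} _ = _ , id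

-- Agreement below n.  This is membership in a cylinder, with explicit
-- quantifiers and as a symmetric relation.
_≈[_]_ : 𝒫ω → ℕ → 𝒫ω → Set
x ≈[ n ] y = ∀ i → i < n → x i ≡ y i

≈-refl : ∀ {x n} → x ≈[ n ] x
≈-refl _ _ = refl

≈-sym : ∀ {x y n} → x ≈[ n ] y → y ≈[ n ] x
≈-sym e i i<n = sym (e i i<n)

≈-trans : ∀ {x y z n} → x ≈[ n ] y → y ≈[ n ] z → x ≈[ n ] z
≈-trans e f i i<n = trans (e i i<n) (f i i<n)

≈-mono : ∀ {x y m n} → m ≤ n → x ≈[ n ] y → x ≈[ m ] y
≈-mono m≤n e i i<m = e i (<-≤-trans i<m m≤n)

-- The set that is A below k and B from k on.
splice : 𝒫ω → ℕ → 𝒫ω → 𝒫ω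
splice A k B i with i <? k
... | yes _ = A i
... | no  _ = B i

splice-below : ∀ A k B {i} → i < k → splice A k B i ≡ A i
splice-below A k B {i} i<k with i <? k
... | yes _   = refl
... | no  i≮k = ⊥-elim (i≮k i<k)

splice-above : ∀ A k B {i} → k ≤ i → splice A k B i ≡ B i
splice-above A k B {i} k≤i with i <? k
... | yes i<k = ⊥-elim (<⇒≱ i<k k≤i)
... | no  _   = refl

≈-splice : ∀ A k B → A ≈[ k ] splice A k B
≈-splice A k B i i<k = sym (splice-below A k B i<k)

-- Box a ℓ B is the closed set of all points that agree with a below ℓ and
-- are contained in B from ℓ on.
Box : 𝒫ω → ℕ → 𝒫ω → Family
Box a ℓ B z = a ≈[ ℓ ] z × (∀ i → ℓ ≤ i → T (z i) → T (B i))

Box-trans : ∀ {a b z ℓ k B C} → ℓ ≤ k → C ⊑ B →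
            Box a ℓ B b → Box b k C z → Box a ℓ B z
Box-trans {a} {b} {z} {ℓ} {k} {B} {C} ℓ≤k C⊑B (a≈b , b⊑B) (b≈z , z⊑C) =
  ≈-trans {a} {b} {z} a≈b (≈-mono {b} {z} ℓ≤k b≈z) , tail
  where
  tail : ∀ i → ℓ ≤ i → T (z i) → T (B i)
  tail i ℓ≤i zi with i <? k
  ... | yes i<k = b⊑B i ℓ≤i (subst T (sym (b≈z i i<k)) zi)
  ... | no  i≮k = C⊑B i (z⊑C i (≮⇒≥ i≮k) zi)

splice-Box : ∀ A k B → Box A k B (splice A k B)
splice-Box A k B = ≈-splice A k B , λ i k≤i → subst T (splice-above A k B k≤i)

-- Sequences

dependent-choice :
  (S : ℕ → Set) (R : ∀ n → S n → S (suc n) → Set) →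
  S 0 → (∀ n s → ∃ (R n s)) →
  ∃ λ (f : ∀ n → S n) → ∀ n → R n (f n) (f (suc n))
dependent-choice S R s₀ step = f , λ n → proj₂ (step n (f n))
  where
  f : ∀ n → S n
  f zero    = s₀
  f (suc n) = proj₁ (step n (f n))

-- A reflexive relation on ℕ that is preserved when its right argument grows
-- by one contains ≤.
ascend : (R : ℕ → ℕ → Set) → (∀ n → R n n) →
         (∀ {m n} → R m n → R m (suc n)) → ∀ {m n} → m ≤ n → R m n
ascend R rfl step m≤n = go (≤⇒≤′ m≤n)
  where
  go : ∀ {m n} → m ≤′ n → R m n
  go ≤′-refl       = rfl _
  go (≤′-step m≤n) = step (go m≤n)

index-< : (ℓ : ℕ → ℕ) → (∀ n → ℓ n < ℓ (suc n)) → ∀ i → i < ℓ (suc i)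
index-< ℓ ℓ< zero    = ≤-<-trans z≤n (ℓ< 0)
index-< ℓ ℓ< (suc i) = ≤-<-trans (index-< ℓ ℓ< i) (ℓ< (suc i))

-- Shrinking boxes that fix longer and longer initial segments have a common
-- point.
fusion : (a B : ℕ → 𝒫ω) (ℓ : ℕ → ℕ) →
         (∀ n → ℓ n < ℓ (suc n)) → (∀ n → B (suc n) ⊑ B n) →
         (∀ n → Box (a n) (ℓ n) (B n) (a (suc n))) →
         ∃ λ x → ∀ n → Box (a n) (ℓ n) (B n) x
fusion a B ℓ ℓ< B⊒ a∈ = x , λ n → agree n , inside n
  where
  x : 𝒫ω
  x i = a (suc i) i

  later : ∀ {m n} → m ≤ n →
          ℓ m ≤ ℓ (suc n) × B (suc n) ⊑ B m × Box (a m) (ℓ m) (B m) (a (suc n))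
  later = ascend _
    (λ n → <⇒≤ (ℓ< n) , B⊒ n , a∈ n)
    (λ {m} {n} (ℓ≤ , ⊒ , bx) →
      <⇒≤ (≤-<-trans ℓ≤ (ℓ< (suc n))) ,
      (λ i → ⊒ i ∘ B⊒ (suc n) i) ,
      Box-trans ℓ≤ ⊒ bx (a∈ (suc n)))

  -- Coordinate i no longer changes after stage i + 1, so x and a later a n
  -- have the same coordinate i.
  stage : ∀ n i → ∃ λ m → Box (a n) (ℓ n) (B n) (a (suc m)) × x i ≡ a (suc m) i
  stage n i = m , proj₂ (proj₂ (later (m≤m⊔n n (suc i)))) ,
              proj₁ (proj₂ (proj₂ (later (m≤n⊔m n (suc i))))) i (index-< ℓ ℓ< i)
    where
    m : ℕ
    m = n ⊔ suc i

  agree : ∀ n → a n ≈[ ℓ n ] x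
  agree n i i<ℓ with stage n i
  ... | _ , (an≈ , _) , xi≡ = trans (an≈ i i<ℓ) (sym xi≡)

  inside : ∀ n i → ℓ n ≤ i → T (x i) → T (B n i)
  inside n i ℓ≤i xi with stage n i
  ... | _ , (_ , ⊑B) , xi≡ = ⊑B i ℓ≤i (subst T xi≡ xi)

-- The case of cylinders, where nothing is required beyond the fixed segments.
fusion-≈ : (a : ℕ → 𝒫ω) (ℓ : ℕ → ℕ) → (∀ n → ℓ n < ℓ (suc n)) →
           (∀ n → a n ≈[ ℓ n ] a (suc n)) →
           ∃ λ x → ∀ n → a n ≈[ ℓ n ] x
fusion-≈ a ℓ ℓ< a≈ with fusion a (const ω) ℓ ℓ< (λ _ _ → id) (λ n → a≈ n , _)
... | x , x∈ = x , λ n → proj₁ (x∈ n)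

-- Countable index sets

ℕ↠List : ℕ ↠ List Bool
ℕ↠List = mk↠ₛ {to = bits ∘ fromℕ} λ s →
  toℕ (code s) , trans (cong bits (fromℕ-toℕ (code s))) (bits-code s)
  where
  bits : ℕᵇ → List Bool
  bits ℕᵇ.zero  = []
  bits 2[1+ b ] = true ∷ bits b
  bits 1+[2 b ] = false ∷ bits b

  code : List Bool → ℕᵇ
  code []          = ℕᵇ.zero
  code (true  ∷ s) = 2[1+ code s ]
  code (false ∷ s) = 1+[2 code s ]

  bits-code : ∀ s → bits (code s) ≡ s
  bits-code []          = refl
  bits-code (true  ∷ s) = cong (true ∷_) (bits-code s)
  bits-code (false ∷ s) = cong (false ∷_) (bits-code s)

-- The string of n ones, a zero, and s encodes the pair (n , s).
ℕ↠ℕ×List : ℕ ↠ (ℕ × List Bool)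
ℕ↠ℕ×List = mk↠ₛ {to = split} (λ (n , s) → join n s , split-join n s) ↠-∘ ℕ↠List
  where
  split : List Bool → ℕ × List Bool
  split []          = 0 , []
  split (false ∷ s) = 0 , s
  split (true  ∷ s) = let n , t = split s in suc n , t

  join : ℕ → List Bool → List Bool
  join zero    s = false ∷ s
  join (suc n) s = true ∷ join n s

  split-join : ∀ n s → split (join n s) ≡ (n , s)
  split-join zero    s = refl
  split-join (suc n) s = cong (λ (n , t) → suc n , t) (split-join n s)

ℕ↠ℕ×ℕ : ℕ ↠ (ℕ × ℕ)
ℕ↠ℕ×ℕ = mk↠ₛ {to = λ (n , s) → n , length s}
                 (λ (m , n) → (m , replicate n false) , cong (m ,_) (length-replicate n))
         ↠-∘ ℕ↠ℕ×List

-- The basic clopen sets, indexed by finite strings.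

-- The string s followed by zeros.
point : List Bool → 𝒫ω
point []      _       = false
point (b ∷ _) zero    = b
point (_ ∷ s) (suc i) = point s i

-- The points that begin with s.
Basic : List Bool → Family
Basic s x = point s ≈[ length s ] x

basic-nbhd : ∀ x n → ∃ λ s → x ∈ Basic s × (∀ {y} → y ∈ Basic s → x ≈[ n ] y)
basic-nbhd x zero = [] , (λ _ ()) , λ _ _ ()
basic-nbhd x (suc n) with basic-nbhd (x ∘ suc) n
... | s , x∈ , close = x 0 ∷ s , here , near
  where
  here : x ∈ Basic (x 0 ∷ s)
  here zero    _   = refl
  here (suc i) i<n = x∈ i (s<s⁻¹ i<n)

  near : ∀ {y} → y ∈ Basic (x 0 ∷ s) → x ≈[ suc n ] y
  near y∈ zero    _   = y∈ 0 (s≤s z≤n)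
  near y∈ (suc i) i<n = close (λ j j<l → y∈ (suc j) (s<s j<l)) i (s<s⁻¹ i<n)

-- Ideals

module _ {J : Family} (ideal : IsIdeal J) where
  open IsIdeal ideal

  ⊑-closed : ∀ {A B} → B ⊑ A → J A → J B
  ⊑-closed B⊑A = ⊆-closed (λ {i} → B⊑A i)

  bounded : ∀ n {A} → (∀ i → T (A i) → i < n) → J A
  bounded n A<n = finite (upTo n , λ {i} Ai → ∈-upTo⁺ (A<n i Ai))

-- The ideal of all sets whose trace on B belongs to M.
_↾_ : Family → 𝒫ω → Family
(M ↾ B) A = M (A ∩ B)

module _ {M : Family} (ideal : IsIdeal M) where
  open IsIdeal ideal

  ⊆-↾ : ∀ B → M ⊆ M ↾ B
  ⊆-↾ B = ⊑-closed ideal (λ _ → proj₁ ∘ to T-∧)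

  ↾-ideal : ∀ {B} → B ∉ M → IsIdeal (M ↾ B)
  ↾-ideal {B} B∉M = record
    { ∪-closed = λ {A} {C} A∈ C∈ → ⊑-closed ideal (distrib A C) (∪-closed A∈ C∈)
    ; ⊆-closed = λ C⊆A → ⊑-closed ideal λ i m →
                   let Ci , Bi = to T-∧ m in from T-∧ (C⊆A Ci , Bi)
    ; finite   = λ {A} fin → ⊆-↾ B {A} (finite fin)
    ; proper   = B∉M
    }
    where
    distrib : ∀ A C → (A ∪ C) ∩ B ⊑ (A ∩ B) ∪ (C ∩ B)
    distrib A C i m with to (T-∧ {A i ∨ C i}) m
    ... | AC , Bi with to (T-∨ {A i}) AC
    ... | inj₁ Ai = from T-∨ (inj₁ (from T-∧ (Ai , Bi)))
    ... | inj₂ Ci = from (T-∨ {A i ∧ B i}) (inj₂ (from T-∧ (Ci , Bi)))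

ideal-≐ : ∀ {J K} → J ≐ K → IsIdeal J → IsIdeal K
ideal-≐ (J⊆K , K⊆J) ideal = record
  { ∪-closed = λ A∈ B∈ → J⊆K (∪-closed (K⊆J A∈) (K⊆J B∈))
  ; ⊆-closed = λ B⊆A A∈ → J⊆K (⊆-closed B⊆A (K⊆J A∈))
  ; finite   = J⊆K ∘ finite
  ; proper   = proper ∘ K⊆J
  }
  where open IsIdeal ideal

-- Open and closed sets

open-≈ : ∀ {U x} → IsOpen U → x ∈ U → ∃ λ n → ∀ {y} → x ≈[ n ] y → y ∈ U
open-≈ {U} {x} U-open x∈U with U-open x∈U
... | n , cyl = n , λ x≈y → cyl (λ {i} i<n → sym (x≈y i i<n))

-- The topological closure.
closure : Family → Family
closure Y x = ∀ n → ∃ λ y → x ≈[ n ] y × y ∈ Y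

closure-extensive : ∀ {Y} → Y ⊆ closure Y
closure-extensive {_} {x} x∈Y n = x , ≈-refl {x} , x∈Y

closure-idem : ∀ {Y} → closure (closure Y) ⊆ closure Y
closure-idem {_} {x} x∈ n with x∈ n
... | y , x≈y , y∈ with y∈ n
... | z , y≈z , z∈ = z , ≈-trans {x} {y} {z} x≈y y≈z , z∈

-- Excluded middle is applied to types with existential quantifiers, so it
-- also provides choice functions.
module Classical (em : ExcludedMiddle 0ℓ) where

  stable : {P : Set} → ¬ ¬ P → P
  stable = decidable-stable em

  ¬∀⇒∃¬ : {A : Set} {P : A → Set} → ¬ (∀ x → P x) → ∃ λ x → ¬ P x
  ¬∀⇒∃¬ ¬all = stable λ none → ¬all λ x → stable λ ¬Px → none (x , ¬Px)

  closed⇒ : ∀ {C} → IsClosed C → closure C ⊆ C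
  closed⇒ C-closed x∈ = stable λ x∉C →
    let n , away = open-≈ C-closed x∉C
        y , x≈y , y∈C = x∈ n
    in away x≈y y∈C

  ⇒closed : ∀ {C} → closure C ⊆ C → IsClosed C
  ⇒closed {C} limit {x} x∉C with ¬∀⇒∃¬ (λ x∈ → x∉C (limit x∈))
  ... | n , none = n , λ {y} y≈x y∈C → none (y , (λ i i<n → sym (y≈x i<n)) , y∈C)

  -- A code of a family is its characteristic function.  Codes form a small
  -- type, so excluded middle applies to statements that quantify over them.
  Code : Set
  Code = 𝒫ω → Bool

  ⟪_⟫ : Code → Family
  ⟪ f ⟫ x = T (f x)

  code : Family → Code
  code X x = isYes (em {X x})

  code-≐ : ∀ X → X ≐ ⟪ code X ⟫
  code-≐ X = fromWitness , toWitness

  closed-code : ∀ {C} → closure C ⊆ C → IsClosed ⟪ code C ⟫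
  closed-code {C} limit = ⇒closed λ x∈ → proj₁ (code-≐ C) (limit λ n →
    let y , x≈y , y∈ = x∈ n in y , x≈y , proj₂ (code-≐ C) y∈)

  -- Compactness of the Cantor space, and generated ideals

  -- Every sequence in the Cantor space has a cluster point.
  cluster-point : (p : ℕ → 𝒫ω) → ∃ λ c → ∀ n → ∃ λ m → n ≤ m × c ≈[ n ] p m
  cluster-point p = c , λ n →
    let m , n≤m , e = proj₂ (proj₁ states n) n
    in m , n≤m , ≈-trans {c} {a n} {p m} (≈-sym {a n} {c} (c≈ n)) e
    where
    -- The sequence returns infinitely often to the cylinder of c below n.
    Often : ℕ → 𝒫ω → Set
    Often n c = ∀ k → ∃ λ m → k ≤ m × c ≈[ n ] p m

    extend : ∀ {n c x} b → c ≈[ n ] x → x n ≡ b → splice c n (const b) ≈[ suc n ] x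
    extend {n} {c} {x} b c≈x xn≡b i i<1+n with m<1+n⇒m<n∨m≡n i<1+n
    ... | inj₁ i<n  = trans (splice-below c n (const b) i<n) (c≈x i i<n)
    ... | inj₂ refl = trans (splice-above c n (const b) ≤-refl) (sym xn≡b)

    step : ∀ n (s : ∃ (Often n)) → ∃ λ (t : ∃ (Often (suc n))) → proj₁ s ≈[ n ] proj₁ t
    step n (c , often) with em {Often (suc n) (splice c n ω)}
    ... | yes o = (splice c n ω , o) , ≈-splice c n ω
    ... | no ¬o with ¬∀⇒∃¬ ¬o
    ... | k₀ , none = (splice c n ∅ , o) , ≈-splice c n ∅
      where
      o : Often (suc n) (splice c n ∅)
      o k with often (k ⊔ k₀)
      ... | m , ≤m , c≈ with p m n in eq
      ...   | false = m , ≤-trans (m≤m⊔n k k₀) ≤m , extend false c≈ eq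
      ...   | true  = ⊥-elim (none (m , ≤-trans (m≤n⊔m k k₀) ≤m , extend true c≈ eq))

    states : ∃ λ (f : ∀ n → ∃ (Often n)) → ∀ n → proj₁ (f n) ≈[ n ] proj₁ (f (suc n))
    states = dependent-choice (∃ ∘ Often) _ (∅ , λ k → k , ≤-refl , λ _ ()) step

    a : ℕ → 𝒫ω
    a n = proj₁ (proj₁ states n)

    limit : ∃ λ x → ∀ n → a n ≈[ n ] x
    limit = fusion-≈ a id n<1+n (proj₂ states)

    c : 𝒫ω
    c = proj₁ limit

    c≈ : ∀ n → a n ≈[ n ] c
    c≈ = proj₂ limit

  -- For C and H closed under limits, so is the family of all z for which
  -- some c in C leaves a remainder z ∖ c in H.
  remainder-closed : ∀ {C H} → closure C ⊆ C → closure H ⊆ H →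
    let D = λ z → ∃ λ c → C c × H (z ∖ c) in closure D ⊆ D
  remainder-closed {C} {H} C-lim H-lim {z} z∈ = c , C-lim c∈ , H-lim z∖c∈
    where
    zs cs : ℕ → 𝒫ω
    zs n = proj₁ (z∈ n)
    cs n = proj₁ (proj₂ (proj₂ (z∈ n)))

    c : 𝒫ω
    c = proj₁ (cluster-point cs)

    c∈ : closure C c
    c∈ n with proj₂ (cluster-point cs) n
    ... | m , _ , e = cs m , e , proj₁ (proj₂ (proj₂ (proj₂ (z∈ m))))

    z∖c∈ : closure H (z ∖ c)
    z∖c∈ n with proj₂ (cluster-point cs) n
    ... | m , n≤m , e = zs m ∖ cs m , near , proj₂ (proj₂ (proj₂ (proj₂ (z∈ m))))
      where
      near : z ∖ c ≈[ n ] zs m ∖ cs m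
      near i i<n rewrite e i i<n | proj₁ (proj₂ (z∈ m)) i (<-≤-trans i<n n≤m) = refl

  module Generate (E : ℕ → Family) (E-closed : ∀ n → IsClosed (E n)) where

    -- An increasing sequence of hereditary closed families: H (suc n) contains
    -- E n and all unions of two members of H n.  A union with first part c
    -- is described by the remainder z ∖ c, so that heredity is automatic and
    -- compactness is needed for the single variable c.
    H : ℕ → Family
    H zero    z = ∀ i → ¬ T (z i)
    H (suc n) z = ∃ λ c → (H n c ⊎ E n c) × H n (z ∖ c)

    H-hereditary : ∀ n {y z} → y ⊑ z → H n z → H n y
    H-hereditary zero    y⊑z z∈ i yi = z∈ i (y⊑z i yi)
    H-hereditary (suc n) y⊑z (c , c∈ , z∖c∈) =
      c , c∈ , H-hereditary n (λ i yi → let y , ¬c = ∖-elim yi in ∖-intro (y⊑z i y) ¬c) z∖c∈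

    H-limit : ∀ n → closure (H n) ⊆ H n
    H-limit zero {z} z∈ i zi with z∈ (suc i)
    ... | y , z≈y , y-empty = y-empty i (subst T (z≈y i ≤-refl) zi)
    H-limit (suc n) = remainder-closed either (H-limit n)
      where
      either : closure (λ c → H n c ⊎ E n c) ⊆ (λ c → H n c ⊎ E n c)
      either {x} x∈ = stable λ neither →
        let far : ∀ {C : Family} → closure C ⊆ C → ¬ C x → ∃ λ k → ∀ y → x ≈[ k ] y → ¬ C y
            far lim x∉ = let k , none = ¬∀⇒∃¬ (λ x∈C → x∉ (lim x∈C))
                         in k , λ y x≈y y∈ → none (y , x≈y , y∈)
            k , ¬H = far (H-limit n) (neither ∘ inj₁)
            l , ¬E = far (closed⇒ (E-closed n)) (neither ∘ inj₂)
            y , x≈y , y∈ = x∈ (k ⊔ l)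
        in [ ¬H y (≈-mono {x} {y} (m≤m⊔n k l) x≈y)
           , ¬E y (≈-mono {x} {y} (m≤n⊔m k l) x≈y) ]′ y∈

    ∅∈H : ∀ n {z} → (∀ i → ¬ T (z i)) → H n z
    ∅∈H zero    empty = empty
    ∅∈H (suc n) {z} empty =
      z , inj₁ (∅∈H n empty) , ∅∈H n (λ i → empty i ∘ proj₁ ∘ ∖-elim)

    self∖ : ∀ n z → H n (z ∖ z)
    self∖ n z = ∅∈H n (λ i zi → let a , ¬a = ∖-elim {z i} zi in ¬a a)

    H-mono : ∀ {m n} → m ≤ n → H m ⊆ H n
    H-mono m≤n = ascend (λ m n → H m ⊆ H n) (λ _ → id)
      (λ {_} {n} ⊆n {z} z∈ → z , inj₁ (⊆n z∈) , self∖ n z) m≤n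

    H-union : ∀ n {y z} → H n y → H n z → H (suc n) (y ∪ z)
    H-union n {y} {z} y∈ z∈ = y , inj₁ y∈ , H-hereditary n rest z∈
      where
      rest : (y ∪ z) ∖ y ⊑ z
      rest i m with ∖-elim {y i ∨ z i} m
      ... | yz , ¬y = [ ⊥-elim ∘ ¬y , id ]′ (to T-∨ yz)

    E⊆H : ⋃ ℕ E ⊆ ⋃ ℕ H
    E⊆H {z} (n , z∈) = suc n , z , inj₂ z∈ , self∖ n z

    H⊆ : ∀ {M} → IsIdeal M → ⋃ ℕ E ⊆ M → ⋃ ℕ H ⊆ M
    H⊆ {M} ideal E⊆M (n , z∈) = go n z∈
      where
      go : ∀ n → H n ⊆ M
      go zero    empty = bounded ideal 0 (λ i → ⊥-elim ∘ empty i)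
      go (suc n) {z} (c , c∈ , z∖c∈) = ⊑-closed ideal split
        (IsIdeal.∪-closed ideal ([ go n , (λ c∈E → E⊆M (n , c∈E)) ]′ c∈) (go n z∖c∈))
        where
        split : z ⊑ c ∪ (z ∖ c)
        split i zi with T? (c i)
        ... | yes ci = from T-∨ (inj₁ ci)
        ... | no  ¬c = from (T-∨ {c i}) (inj₂ (∖-intro zi ¬c))

  -- Closed sets covering an ideal J inside an ideal M generate an ideal that
  -- is Fσ.
  generated-Fσ-ideal :
    ∀ {J M} → IsIdeal J → IsIdeal M →
    (E : ℕ → Family) → (∀ n → IsClosed (E n)) → J ⊆ ⋃ ℕ E → ⋃ ℕ E ⊆ M →
    ∃ λ (J′ : Family) → IsIdeal J′ × IsFσ J′ × J ⊆ J′
  generated-Fσ-ideal {J} J-ideal M-ideal E E-closed J⊆E E⊆M =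
    ⋃ ℕ H , ideal , (H , (λ n → ⇒closed (H-limit n)) , id , id) , E⊆H ∘ J⊆E
    where
    open Generate E E-closed

    ideal : IsIdeal (⋃ ℕ H)
    ideal = record
      { ∪-closed = λ (m , A∈) (n , B∈) →
          suc (m ⊔ n) , H-union (m ⊔ n) (H-mono (m≤m⊔n m n) A∈) (H-mono (m≤n⊔m m n) B∈)
      ; ⊆-closed = λ B⊆A (n , A∈) → n , H-hereditary n (λ i → B⊆A {i}) A∈
      ; finite   = λ fin → E⊆H (J⊆E (IsIdeal.finite J-ideal fin))
      ; proper   = IsIdeal.proper M-ideal ∘ H⊆ M-ideal E⊆M
      }

  -- Coverable families

  -- Y can be covered by countably many closed subsets of M.
  Coverable : Family → Family → Set
  Coverable M Y = ∃ λ (C : ℕ → Code) →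
    (∀ n → IsClosed ⟪ C n ⟫) × (∀ n → ⟪ C n ⟫ ⊆ M) × Y ⊆ ⋃ ℕ (λ n → ⟪ C n ⟫)

  coverable-⊆ : ∀ {M N Y Z} → M ⊆ N → Z ⊆ Y → Coverable M Y → Coverable N Z
  coverable-⊆ M⊆N Z⊆Y (C , closed , C⊆M , Y⊆C) =
    C , closed , (λ n → M⊆N ∘ C⊆M n) , Y⊆C ∘ Z⊆Y

  coverable-closed : ∀ {M Y} → closure Y ⊆ Y → Y ⊆ M → Coverable M Y
  coverable-closed {M} {Y} limit Y⊆M =
    (λ _ → code Y) , (λ _ → closed-code limit) , (λ _ → Y⊆M ∘ proj₂ (code-≐ Y)) ,
    λ x∈ → 0 , proj₁ (code-≐ Y) x∈

  coverable-⋃ : ∀ {I : Set} {M} {Y : I → Family} → ℕ ↠ I →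
                (∀ i → Coverable M (Y i)) → Coverable M (⋃ I Y)
  coverable-⋃ {I} {M} {Y} enum cov = C , closed , C⊆M , covers
    where
    module I = Surjection enum
    module P = Surjection ℕ↠ℕ×ℕ

    piece : I × ℕ → Code
    piece (i , n) = proj₁ (cov i) n

    index : ℕ → I × ℕ
    index k = let m , n = P.to k in I.to m , n

    C : ℕ → Code
    C k = piece (index k)

    closed : ∀ k → IsClosed ⟪ C k ⟫
    closed k = let i , n = index k in proj₁ (proj₂ (cov i)) n

    C⊆M : ∀ k → ⟪ C k ⟫ ⊆ M
    C⊆M k = let i , n = index k in proj₁ (proj₂ (proj₂ (cov i))) n

    covers : ⋃ I Y ⊆ ⋃ ℕ (λ k → ⟪ C k ⟫)
    covers {x} (i , x∈) with proj₂ (proj₂ (proj₂ (cov i))) x∈ | I.surjective i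
    ... | n , x∈n | m , m↦i with P.surjective (m , n)
    ... | k , k↦mn = k , subst (λ j → T (piece j x)) (sym index≡) x∈n
      where
      index≡ : index k ≡ (i , n)
      index≡ = trans (cong (λ (m , n) → I.to m , n) (k↦mn refl)) (cong (_, n) (m↦i refl))

  coverable-∪ : ∀ {M Y Z} → Coverable M Y → Coverable M Z →
                Coverable M (λ x → Y x ⊎ Z x)
  coverable-∪ {M} {Y} {Z} covY covZ =
    coverable-⊆ id [ (0 ,_) , (1 ,_) ]′ (coverable-⋃ (mk↠ₛ {to = id} (λ n → n , refl)) cov)
    where
    YZ : ℕ → Family
    YZ zero    = Y
    YZ (suc _) = Z

    cov : ∀ n → Coverable M (YZ n)
    cov zero    = covY
    cov (suc _) = covZ

  -- Given countably many families, an ideal can be enlarged so that every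
  -- family which a still larger ideal allows to cover is covered already:
  -- the families are treated one after another, and the union of an
  -- increasing sequence of proper ideals is a proper ideal.
  decisive-extension :
    ∀ {I : Set} {J} → ℕ ↠ I → (Y : I → Family) → IsIdeal J →
    ∃ λ (M : Family) → IsIdeal M × J ⊆ M ×
      (∀ i {N} → IsIdeal N → M ⊆ N → Coverable N (Y i) → Coverable M (Y i))
  decisive-extension {I} {J} enum Y J-ideal = M , M-ideal , J⊆M , decides
    where
    module I = Surjection enum

    CodedIdeal : Set
    CodedIdeal = ∃ λ f → IsIdeal ⟪ f ⟫

    Next : ℕ → CodedIdeal → CodedIdeal → Set
    Next n (f , _) (g , _) = ⟪ f ⟫ ⊆ ⟪ g ⟫ ×
      (∀ h → IsIdeal ⟪ h ⟫ → ⟪ g ⟫ ⊆ ⟪ h ⟫ →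
       Coverable ⟪ h ⟫ (Y (I.to n)) → Coverable ⟪ g ⟫ (Y (I.to n)))

    next : ∀ n s → ∃ (Next n s)
    next n (f , f-ideal)
      with em {∃ λ h → IsIdeal ⟪ h ⟫ × ⟪ f ⟫ ⊆ ⟪ h ⟫ × Coverable ⟪ h ⟫ (Y (I.to n))}
    ... | yes (h , h-ideal , f⊆h , cov) = (h , h-ideal) , f⊆h , λ _ _ _ _ → cov
    ... | no none = (f , f-ideal) , id , λ h h-ideal f⊆h cov →
                      ⊥-elim (none (h , h-ideal , f⊆h , cov))

    start : CodedIdeal
    start = code J , ideal-≐ (code-≐ J) J-ideal

    sequence : ∃ λ (f : ℕ → CodedIdeal) → ∀ n → Next n (f n) (f (suc n))
    sequence = dependent-choice (const CodedIdeal) Next start next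

    Mₙ : ℕ → Family
    Mₙ n = ⟪ proj₁ (proj₁ sequence n) ⟫

    ideals : ∀ n → IsIdeal (Mₙ n)
    ideals n = proj₂ (proj₁ sequence n)

    mono : ∀ {m n} → m ≤ n → Mₙ m ⊆ Mₙ n
    mono m≤n = ascend (λ m n → Mₙ m ⊆ Mₙ n) (λ _ → id)
      (λ {_} {n} ⊆n → proj₁ (proj₂ sequence n) ∘ ⊆n) m≤n

    M : Family
    M = ⋃ ℕ Mₙ

    J⊆M : J ⊆ M
    J⊆M A∈ = 0 , proj₁ (code-≐ J) A∈

    M-ideal : IsIdeal M
    M-ideal = record
      { ∪-closed = λ (m , A∈) (n , B∈) → m ⊔ n ,
          IsIdeal.∪-closed (ideals (m ⊔ n)) (mono (m≤m⊔n m n) A∈) (mono (m≤n⊔m m n) B∈)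
      ; ⊆-closed = λ B⊆A (n , A∈) → n , IsIdeal.⊆-closed (ideals n) B⊆A A∈
      ; finite   = λ fin → 0 , IsIdeal.finite (ideals 0) fin
      ; proper   = λ (n , ω∈) → IsIdeal.proper (ideals n) ω∈
      }

    decides : ∀ i {N} → IsIdeal N → M ⊆ N → Coverable N (Y i) → Coverable M (Y i)
    decides i {N} N-ideal M⊆N cov with I.surjective i
    ... | n , n↦i with n↦i refl
    ... | refl = coverable-⊆ (suc n ,_) id
      (proj₂ (proj₂ sequence n) (code N) (ideal-≐ (code-≐ N) N-ideal)
        (λ A∈ → proj₁ (code-≐ N) (M⊆N (suc n , A∈)))
        (coverable-⊆ (proj₁ (code-≐ N)) id cov))

  -- Gδ subfamilies of an ideal

  -- A Gδ family that is dense in a box has two members that together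
  -- contain B from ℓ on.  They are built alternately: while one of them
  -- waits to enter the next open set, the other one copies B.
  dense⇒covering-pair :
    ∀ {H} → IsGδ H → ∀ a ℓ B →
    (∀ b k → ℓ < k → Box a ℓ B b → ∃ λ z → Box b k B z × H z) →
    ∃ λ x → ∃ λ y → H x × H y × (∀ i → ℓ ≤ i → T (B i) → T (x i) ⊎ T (y i))
  dense⇒covering-pair {H} (U , U-open , H⊆U , U⊆H) a ℓ B dense =
    x , y , U⊆H x∈U , U⊆H y∈U , covered
    where
    -- Approximations p and q of the two members, final below k; there they
    -- already cover B.
    record State : Set where
      field
        p q   : 𝒫ω
        k     : ℕ
        ℓ<k   : ℓ < k
        p∈    : Box a ℓ B p
        q∈    : Box a ℓ B q
        cover : ∀ i → ℓ ≤ i → i < k → T (B i) → T (p i) ⊎ T (q i)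
    open State

    Next : ℕ → State → State → Set
    Next n s t =
      k s < k t × p s ≈[ k s ] p t × q s ≈[ k s ] q t ×
      (∀ {x} → p t ≈[ k t ] x → U n x) × (∀ {y} → q t ≈[ k t ] y → U n y)

    next : ∀ n s → ∃ (Next n s)
    next n s = t , k< , p≈ , q≈ , p-in , q-in
      where
      first : ∃ λ z → Box (p s) (k s) B z × H z
      first = dense (p s) (k s) (ℓ<k s) (p∈ s)

      z : 𝒫ω
      z = proj₁ first

      z-near : ∃ λ m → ∀ {x} → z ≈[ m ] x → U n x
      z-near = open-≈ (U-open n) (H⊆U (proj₂ (proj₂ first)) n)

      k₁ : ℕ
      k₁ = k s ⊔ proj₁ z-near

      k≤k₁ : k s ≤ k₁
      k≤k₁ = m≤m⊔n (k s) (proj₁ z-near)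

      ℓ≤k₁ : ℓ ≤ k₁
      ℓ≤k₁ = ≤-trans (<⇒≤ (ℓ<k s)) k≤k₁

      -- The second member copies B on the interval from k s to k₁.
      q₁ : 𝒫ω
      q₁ = splice (q s) (k s) B

      q₁∈ : Box a ℓ B q₁
      q₁∈ = Box-trans (<⇒≤ (ℓ<k s)) (λ _ → id) (q∈ s) (splice-Box (q s) (k s) B)

      second : ∃ λ w → Box q₁ k₁ B w × H w
      second = dense q₁ k₁ (<-≤-trans (ℓ<k s) k≤k₁) q₁∈

      w : 𝒫ω
      w = proj₁ second

      q₁≈w : q₁ ≈[ k₁ ] w
      q₁≈w = proj₁ (proj₁ (proj₂ second))

      w-near : ∃ λ m → ∀ {y} → w ≈[ m ] y → U n y
      w-near = open-≈ (U-open n) (H⊆U (proj₂ (proj₂ second)) n)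

      k₂ : ℕ
      k₂ = suc (k₁ ⊔ proj₁ w-near)

      k₁<k₂ : k₁ < k₂
      k₁<k₂ = s≤s (m≤m⊔n k₁ (proj₁ w-near))

      -- The first member copies B from k₁ on.
      p₁ : 𝒫ω
      p₁ = splice z k₁ B

      k< : k s < k₂
      k< = ≤-<-trans k≤k₁ k₁<k₂

      p≈ : p s ≈[ k s ] p₁
      p≈ = ≈-trans {p s} {z} {p₁} (proj₁ (proj₁ (proj₂ first)))
             (≈-mono {z} {p₁} k≤k₁ (≈-splice z k₁ B))

      q≈ : q s ≈[ k s ] w
      q≈ = ≈-trans {q s} {q₁} {w} (≈-splice (q s) (k s) B) (≈-mono {q₁} {w} k≤k₁ q₁≈w)

      p-in : ∀ {x} → p₁ ≈[ k₂ ] x → U n x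
      p-in {x} e = proj₂ z-near (≈-mono {z} {x} (m≤n⊔m (k s) _)
        (≈-trans {z} {p₁} {x} (≈-splice z k₁ B) (≈-mono {p₁} {x} (<⇒≤ k₁<k₂) e)))

      q-in : ∀ {y} → w ≈[ k₂ ] y → U n y
      q-in {y} e = proj₂ w-near
        (≈-mono {w} {y} (<⇒≤ (s≤s (m≤n⊔m k₁ (proj₁ w-near)))) e)

      covers : ∀ i → ℓ ≤ i → i < k₂ → T (B i) → T (p₁ i) ⊎ T (w i)
      covers i ℓ≤i _ Bi with <-≤-connex i (k s) | <-≤-connex i k₁
      ... | inj₁ i<k | _ = Sum.map (subst T (p≈ i i<k)) (subst T (q≈ i i<k)) (cover s i ℓ≤i i<k Bi)
      ... | inj₂ k≤i | inj₁ i<k₁ =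
        inj₂ (subst T (trans (sym (splice-above (q s) (k s) B k≤i)) (q₁≈w i i<k₁)) Bi)
      ... | inj₂ _   | inj₂ k₁≤i =
        inj₁ (subst T (sym (splice-above z k₁ B k₁≤i)) Bi)

      t : State
      t = record
        { p = p₁ ; q = w ; k = k₂ ; ℓ<k = <-≤-trans (ℓ<k s) (<⇒≤ k<)
        ; p∈ = Box-trans ℓ≤k₁ (λ _ → id)
                 (Box-trans (<⇒≤ (ℓ<k s)) (λ _ → id) (p∈ s) (proj₁ (proj₂ first)))
                 (splice-Box z k₁ B)
        ; q∈ = Box-trans ℓ≤k₁ (λ _ → id) q₁∈ (proj₁ (proj₂ second))
        ; cover = covers
        }

    start : State
    start = record
      { p = splice a ℓ B ; q = splice a ℓ B ; k = suc ℓ ; ℓ<k = ≤-refl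
      ; p∈ = splice-Box a ℓ B ; q∈ = splice-Box a ℓ B
      ; cover = λ i ℓ≤i _ Bi → inj₁ (subst T (sym (splice-above a ℓ B ℓ≤i)) Bi)
      }

    states : ∃ λ (f : ℕ → State) → ∀ n → Next n (f n) (f (suc n))
    states = dependent-choice (const State) Next start next

    s : ℕ → State
    s = proj₁ states

    x-limit : ∃ λ x → ∀ n → p (s n) ≈[ k (s n) ] x
    x-limit = fusion-≈ (p ∘ s) (k ∘ s) (proj₁ ∘ proj₂ states) (proj₁ ∘ proj₂ ∘ proj₂ states)

    y-limit : ∃ λ y → ∀ n → q (s n) ≈[ k (s n) ] y
    y-limit = fusion-≈ (q ∘ s) (k ∘ s) (proj₁ ∘ proj₂ states)
                (proj₁ ∘ proj₂ ∘ proj₂ ∘ proj₂ states)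

    x y : 𝒫ω
    x = proj₁ x-limit
    y = proj₁ y-limit

    x∈U : ∀ n → U n x
    x∈U n = proj₁ (proj₂ (proj₂ (proj₂ (proj₂ states n)))) (proj₂ x-limit (suc n))

    y∈U : ∀ n → U n y
    y∈U n = proj₂ (proj₂ (proj₂ (proj₂ (proj₂ states n)))) (proj₂ y-limit (suc n))

    covered : ∀ i → ℓ ≤ i → T (B i) → T (x i) ⊎ T (y i)
    covered i ℓ≤i Bi =
      Sum.map (subst T (proj₂ x-limit (suc i) i i<k)) (subst T (proj₂ y-limit (suc i) i i<k))
              (cover (s (suc i)) i ℓ≤i i<k Bi)
      where
      i<k : i < k (s (suc i))
      i<k = index-< (k ∘ s) (proj₁ ∘ proj₂ states) i

  -- A Gδ subfamily of an ideal is not dense in a box over a set B outside the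
  -- ideal, since two of its members do not cover B up to a finite set: a
  -- smaller box avoids it.
  avoiding-box :
    ∀ {J H} → IsIdeal J → IsGδ H → H ⊆ J → ∀ a ℓ {B} → B ∉ J →
    ∃ λ b → ∃ λ k → ℓ < k × Box a ℓ B b × (∀ z → Box b k B z → z ∉ H)
  avoiding-box {J} {H} ideal Hδ H⊆J a ℓ {B} B∉J = stable λ none →
    let dense : ∀ b k → ℓ < k → Box a ℓ B b → ∃ λ z → Box b k B z × H z
        dense b k ℓ<k b∈ = stable λ avoids →
          none (b , k , ℓ<k , b∈ , λ z z∈ z∈H → avoids (z , z∈ , z∈H))
        x , y , x∈H , y∈H , cover = dense⇒covering-pair Hδ a ℓ B dense
    in B∉J (⊑-closed ideal (split x y cover)
         (∪-closed (bounded ideal ℓ below) (∪-closed (H⊆J x∈H) (H⊆J y∈H))))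
    where
    open IsIdeal ideal

    below : ∀ i → T (splice ω ℓ ∅ i) → i < ℓ
    below i m with i <? ℓ
    ... | yes i<ℓ = i<ℓ

    split : ∀ x y → (∀ i → ℓ ≤ i → T (B i) → T (x i) ⊎ T (y i)) →
            B ⊑ splice ω ℓ ∅ ∪ (x ∪ y)
    split x y cover i Bi with i <? ℓ
    ... | yes _   = _
    ... | no  i≮ℓ = from (T-∨ {x i}) (cover i (≮⇒≥ i≮ℓ) Bi)

  -- Coverability of the Gδ subfamilies of J = ⋃ H n

  module _
    {J M : Family} (J-ideal : IsIdeal J) (M-ideal : IsIdeal M) (J⊆M : J ⊆ M)
    (H : ℕ → Family) (Hδ : ∀ n → IsGδ (H n)) (J≐H : J ≐ ⋃ ℕ H)
    {G : Family} (Gδ : IsGδ G) (G⊆J : G ⊆ J)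
    (decided : ∀ s {N} → IsIdeal N → M ⊆ N →
               Coverable N (λ x → G x × Basic s x) →
               Coverable M (λ x → G x × Basic s x))
    where

    private
      Portion : List Bool → Family
      Portion s x = G x × Basic s x

      -- The members of G none of whose basic neighbourhoods in G is coverable.
      Kernel : Family
      Kernel x = G x × (∀ s → Basic s x → ¬ Coverable M (Portion s))

      coverable-off-kernel : Coverable M (λ x → G x × ¬ Kernel x)
      coverable-off-kernel = coverable-⊆ id inside (coverable-⋃ ℕ↠List cov)
        where
        Small : List Bool → Family
        Small s x = Portion s x × Coverable M (Portion s)

        inside : (λ x → G x × ¬ Kernel x) ⊆ ⋃ (List Bool) Small
        inside (Gx , x∉) with ¬∀⇒∃¬ (λ all → x∉ (Gx , all))
        ... | s , ¬all with ¬∀⇒∃¬ ¬all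
        ... | x∈s , ¬¬cov = s , (Gx , x∈s) , stable ¬¬cov

        cov : ∀ s → Coverable M (Small s)
        cov s with em {Coverable M (Portion s)}
        ... | yes c = coverable-⊆ id proj₁ c
        ... | no ¬c = coverable-⊆ id (λ (_ , c) → ¬c c)
                        (coverable-closed {Y = const ⊥} (λ x∈ → proj₂ (proj₂ (x∈ 0))) λ ())

      -- Near a kernel point the closure of the kernel is not contained in
      -- M ↾ B when B is outside M: otherwise the ideal M ↾ B would cover a
      -- portion of G that M does not.
      escape : ∀ {x B} n → Kernel x → B ∉ M →
               ∃ λ q → closure Kernel q × x ≈[ n ] q × (q ∩ B) ∉ M
      escape {x} {B} n (_ , x-large) B∉M with basic-nbhd x n
      ... | s , x∈s , close = stable λ none →
        let near⊆ : Near ⊆ M ↾ B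
            near⊆ {q} q∈ = stable λ q∩B∉M → none
              (q , (λ m → let y , q≈y , y∈ , _ = q∈ m in y , q≈y , y∈) ,
               (let y , q≈y , _ , y∈s = q∈ n
                in ≈-trans {x} {y} {q} (close y∈s) (≈-sym {q} {y} q≈y)) ,
               q∩B∉M)
        in x-large s x∈s (decided s (↾-ideal M-ideal B∉M) (⊆-↾ M-ideal B)
             (coverable-⊆ id split (coverable-∪
               (coverable-⊆ (⊆-↾ M-ideal B) id coverable-off-kernel)
               (coverable-closed closure-idem near⊆))))
        where
        Near : Family
        Near = closure (λ y → Kernel y × Basic s y)

        split : Portion s ⊆ (λ y → (G y × ¬ Kernel y) ⊎ Near y)
        split {y} (Gy , y∈s) with em {Kernel y}
        ... | yes y∈ = inj₂ (closure-extensive (y∈ , y∈s))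
        ... | no  y∉ = inj₁ (Gy , y∉)

      U : ℕ → Family
      U = proj₁ Gδ

      -- A stage of the construction of A ⊆ x with x in G: below ℓ the sets A
      -- and x are given by a and q, and from ℓ on A will stay inside B.
      record State : Set where
        field
          ℓ     : ℕ
          a q B : 𝒫ω
          q∈    : closure Kernel q
          B∉M   : B ∉ M
          a⊑q   : a ⊑ q
      open State

      Next : ℕ → State → State → Set
      Next n s t =
        ℓ s < ℓ t × B t ⊑ B s × Box (a s) (ℓ s) (B s) (a t) × q s ≈[ ℓ s ] q t ×
        (∀ {x} → q t ≈[ ℓ t ] x → U n x) × (∀ z → Box (a t) (ℓ t) (B t) z → ¬ H n z)

      -- Passing from q to q′ close to x, whose neighbourhood below m lies in
      -- U n.  The set A is left empty between ℓ and ℓ ⊔ m, since the old B need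
      -- not be contained in q′; beyond, the new B is a subset of q′.
      advance : ∀ n s {x m q′ b k} →
        q s ≈[ ℓ s ] x → (∀ {y} → x ≈[ m ] y → U n y) →
        closure Kernel q′ → x ≈[ ℓ s ⊔ m ] q′ → (q′ ∩ B s) ∉ M →
        ℓ s ⊔ m < k → Box (splice (a s) (ℓ s) ∅) (ℓ s ⊔ m) (q′ ∩ B s) b →
        (∀ z → Box b k (q′ ∩ B s) z → ¬ H n z) → ∃ (Next n s)
      advance n s {x} {m} {q′} {b} {k} q≈x x-in q′∈ x≈q′ q′∩B∉M l<k b∈@(a≈b , b⊑) avoids =
        record { ℓ = k ; a = b ; q = q′ ; B = q′ ∩ B s
               ; q∈ = q′∈ ; B∉M = q′∩B∉M ; a⊑q = b⊑q′ } ,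
        ≤-<-trans ℓ≤l l<k ,
        (λ _ → proj₂ ∘ to T-∧) ,
        Box-trans ℓ≤l (λ _ → proj₂ ∘ to T-∧) cut∈ b∈ ,
        q≈q′ ,
        (λ {y} q′≈y → x-in (≈-mono {x} {y} (m≤n⊔m (ℓ s) m)
          (≈-trans {x} {q′} {y} x≈q′ (≈-mono {q′} {y} (<⇒≤ l<k) q′≈y)))) ,
        avoids
        where
        ℓ≤l : ℓ s ≤ ℓ s ⊔ m
        ℓ≤l = m≤m⊔n (ℓ s) m

        q≈q′ : q s ≈[ ℓ s ] q′
        q≈q′ = ≈-trans {q s} {x} {q′} q≈x (≈-mono {x} {q′} ℓ≤l x≈q′)

        cut∈ : Box (a s) (ℓ s) (B s) (splice (a s) (ℓ s) ∅)
        cut∈ = ≈-splice (a s) (ℓ s) ∅ ,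
               λ i ℓ≤i → ⊥-elim ∘ subst T (splice-above (a s) (ℓ s) ∅ ℓ≤i)

        b⊑q′ : b ⊑ q′
        b⊑q′ i bi with <-≤-connex i (ℓ s ⊔ m) | <-≤-connex i (ℓ s)
        ... | inj₂ l≤i | _        = proj₁ (to T-∧ (b⊑ i l≤i bi))
        ... | inj₁ i<l | inj₂ ℓ≤i = ⊥-elim (subst T
          (trans (sym (a≈b i i<l)) (splice-above (a s) (ℓ s) ∅ ℓ≤i)) bi)
        ... | inj₁ i<l | inj₁ i<ℓ = subst T (q≈q′ i i<ℓ) (a⊑q s i (subst T
          (trans (sym (a≈b i i<l)) (splice-below (a s) (ℓ s) ∅ i<ℓ)) bi))

      next : ∀ n s → ∃ (Next n s)
      next n s =
        let x , q≈x , Kx = q∈ s (ℓ s)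
            m , x-in = open-≈ (proj₁ (proj₂ Gδ) n) (proj₁ (proj₂ (proj₂ Gδ)) (proj₁ Kx) n)
            q′ , q′∈ , x≈q′ , q′∩B∉M = escape (ℓ s ⊔ m) Kx (B∉M s)
            b , k , l<k , b∈ , avoids =
              avoiding-box J-ideal (Hδ n) (λ z∈ → proj₂ J≐H (n , z∈))
                (splice (a s) (ℓ s) ∅) (ℓ s ⊔ m) (q′∩B∉M ∘ J⊆M)
        in advance n s q≈x x-in q′∈ x≈q′ q′∩B∉M l<k b∈ avoids

      -- The limit A would be a subset of the limit x in G, hence a member of J,
      -- and yet avoid every H n.
      no-construction : (s : ℕ → State) → (∀ n → Next n (s n) (s (suc n))) → ⊥
      no-construction s stages = let n , A∈H = proj₁ J≐H A∈J in A∉H n A∈H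
        where
        ℓ< : ∀ n → ℓ (s n) < ℓ (s (suc n))
        ℓ< = proj₁ ∘ stages

        A-limit : ∃ λ A → ∀ n → Box (a (s n)) (ℓ (s n)) (B (s n)) A
        A-limit = fusion (a ∘ s) (B ∘ s) (ℓ ∘ s) ℓ<
          (proj₁ ∘ proj₂ ∘ stages) (proj₁ ∘ proj₂ ∘ proj₂ ∘ stages)

        x-limit : ∃ λ x → ∀ n → q (s n) ≈[ ℓ (s n) ] x
        x-limit = fusion-≈ (q ∘ s) (ℓ ∘ s) ℓ<
          (proj₁ ∘ proj₂ ∘ proj₂ ∘ proj₂ ∘ stages)

        A x : 𝒫ω
        A = proj₁ A-limit
        x = proj₁ x-limit

        x∈G : G x
        x∈G = proj₂ (proj₂ (proj₂ Gδ)) λ n →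
          proj₁ (proj₂ (proj₂ (proj₂ (proj₂ (stages n))))) (proj₂ x-limit (suc n))

        A⊑x : A ⊑ x
        A⊑x i Ai = subst T (proj₂ x-limit (suc i) i i<ℓ)
          (a⊑q (s (suc i)) i (subst T (sym (proj₁ (proj₂ A-limit (suc i)) i i<ℓ)) Ai))
          where
          i<ℓ : i < ℓ (s (suc i))
          i<ℓ = index-< (ℓ ∘ s) ℓ< i

        A∈J : J A
        A∈J = ⊑-closed J-ideal A⊑x (G⊆J x∈G)

        A∉H : ∀ n → ¬ H n A
        A∉H n = proj₂ (proj₂ (proj₂ (proj₂ (proj₂ (stages n))))) A (proj₂ A-limit (suc n))

      kernel-empty : ∀ {x} → ¬ Kernel x
      kernel-empty {x} Kx =
        let s , stages = dependent-choice (const State) Next start next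
        in no-construction s stages
        where
        start : State
        start = record
          { ℓ = 0 ; a = ∅ ; q = x ; B = ω ; q∈ = closure-extensive Kx
          ; B∉M = IsIdeal.proper M-ideal ; a⊑q = λ _ () }

    -- A Gδ subfamily of J whose portions are decided by M is M-coverable.
    Gδ-coverable : Coverable M G
    Gδ-coverable = coverable-⊆ id (λ Gx → Gx , kernel-empty) coverable-off-kernel

proposition10p1 : ExcludedMiddle 0ℓ →
    (J : Family) → IsIdeal J → IsGδσ J →
    ∃ λ (J′ : Family) → IsIdeal J′ × IsFσ J′ × J ⊆ J′
proposition10p1 em J J-ideal (G , Gδ , J≐G) =
  let M , M-ideal , J⊆M , decides =
        decisive-extension ℕ↠ℕ×List (λ (n , s) x → G n x × Basic s x) J-ideal
      C , closed , C⊆M , covers =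
        coverable-⋃ (mk↠ₛ {to = id} λ n → n , refl) λ n →
          Gδ-coverable J-ideal M-ideal J⊆M G Gδ J≐G (Gδ n) (λ x∈ → proj₂ J≐G (n , x∈))
            (λ s → decides (n , s))
  in generated-Fσ-ideal J-ideal M-ideal (λ n → ⟪ C n ⟫) closed
       (covers ∘ proj₁ J≐G) (λ (n , x∈) → C⊆M n x∈)
  where open Classical em
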